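{- Let $G$ be a connected nontrivial graph and let $H$ be a nontrivial graph. Then $$\gamma^p(G\circ H)=\begin{cases}\gamma_t(G) & \text{if } \delta(H)=0 \text{ and } G \text{ is an efficient open domination graph},\\ \gamma(G) & \text{if } \gamma(H)=1 \text{ and } G \text{ is an efficient closed domination graph},\\ |V(G)|\,|V(H)| & \text{otherwise.}\end{cases}$$
   Context: All graphs are finite, simple and undirected; a graph is nontrivial if it has at least two vertices. $\delta(H)$ is the minimum degree of $H$. $N(v)$ is the open neighbourhood and $N[v]=N(v)\cup\{v\}$. A set $S\subseteq V(G)$ is dominating if every vertex of $V(G)\setminus S$ is adjacent to at least one vertex of $S$; $\gamma(G)$ is the minimum size of a dominating set. $S$ is a perfect dominating set if every vertex of $V(G)\setminus S$ is adjacent to exactly one vertex of $S$; $\gamma^p(G)$ is the minimum size of a perfect dominating set. For $G$ without isolated vertices, $S$ is a total dominating set if every vertex of $V(G)$ is adjacent to at least one vertex of $S$; $\gamma_t(G)$ is the minimum size of a total dominating set. $G$ is an efficient open domination graph if there is a set $D\subseteq V(G)$ with $V(G)=\bigcup_{u\in D}N(u)$ and $N(u)\cap N(v)=\varnothing$ for all distinct $u,v\in D$. A packing is a set $S$ with $N[u]\cap N[v]=\varnothing$ for all distinct $u,v\in S$. $G$ is an efficient closed domination graph if some set $S\subseteq V(G)$ is both a dominating set and a packing. The lexicographic product $G\circ H$ has vertex set $V(G)\times V(H)$, with $(u,v)$ adjacent to $(x,y)$ iff $ux\in E(G)$, or $u=x$ and $vy\in E(H)$. -}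

module Defs where

open import Level using (0ℓ)
open import Data.Nat using (ℕ; zero; suc; _*_; _≤_)
open import Data.Nat.Properties using (≤-antisym; ≤-reflexive; ≤-trans)
open import Data.Fin using (Fin; remQuot)
open import Data.Fin.Properties using (_≟_; all?; any?)
open import Data.Fin.Subset
  using (Subset; inside; outside; _∈_; _∉_; _∩_; _∪_; ⁅_⁆; ∣_∣; Empty)
open import Data.Fin.Subset.Properties using (_∈?_; ∣p∣≤n)
open import Data.List using (List; [_]; _++_; map; filter; allFin)
open import Data.List.Extrema.Nat using (min; min≤xs; argmin-sel)
open import Data.List.Membership.Propositional using () renaming (_∈_ to _∈ˡ_)
open import Data.List.Membership.Propositional.Properties
  using (∈-++⁺ˡ; ∈-++⁺ʳ; ∈-map⁺; ∈-map⁻; ∈-filter⁺; ∈-filter⁻)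
open import Data.List.Relation.Unary.Any using (here)
import Data.List.Relation.Unary.All as All
open import Data.Product using (_×_; _,_; ∃; ∃!; Σ-syntax)
open import Data.Product.Relation.Binary.Lex.Strict
  using (×-Lex; ×-decidable)
open import Data.Sum using (inj₁; inj₂)
open import Data.Vec using (tabulate; []; _∷_)
open import Function using (_on_; id)
open import Relation.Binary.Core using (Rel)
open import Relation.Binary.Definitions
  using (Symmetric; Irreflexive) renaming (Decidable to Decidable₂)
open import Relation.Binary.Construct.Closure.ReflexiveTransitive using (Star)
open import Relation.Binary.PropositionalEquality
  using (_≡_; _≢_; refl; sym)
open import Relation.Nullary using (Dec; does; ¬?; _×-dec_; _→-dec_)
open import Relation.Nullary.Decidable using (map′)
open import Relation.Unary using (Pred; Decidable)

private
  variable
    m n : ℕ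

record Graph (n : ℕ) : Set₁ where
  infix 4 _~_ _~?_
  field
    _~_    : Rel (Fin n) 0ℓ
    _~?_   : Decidable₂ _~_
    symm   : Symmetric _~_
    irrefl : Irreflexive _≡_ _~_

open Graph

Nontrivial : Graph n → Set
Nontrivial {n} G = 2 ≤ n

Connected : Graph n → Set
Connected G = ∀ u v → Star (_~_ G) u v

N : Graph n → Fin n → Subset n
N G v = tabulate λ u → does (_~?_ G v u)

N[_] : Graph n → Fin n → Subset n
N[ G ] v = N G v ∪ ⁅ v ⁆

deg : Graph n → Fin n → ℕ
deg G v = ∣ N G v ∣

-- `min` takes a default for the empty list and includes it in the minimum.
-- The default n exceeds every degree, so it is harmless as soon as there is
-- a vertex.
δ : Graph n → ℕ
δ {n} G = min n (map (deg G) (allFin n))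

Dominating : Graph n → Pred (Subset n) 0ℓ
Dominating G S = ∀ v → v ∉ S → ∃ λ u → u ∈ S × _~_ G v u

PerfectDominating : Graph n → Pred (Subset n) 0ℓ
PerfectDominating G S = ∀ v → v ∉ S → ∃! _≡_ λ u → u ∈ S × _~_ G v u

TotalDominating : Graph n → Pred (Subset n) 0ℓ
TotalDominating G S = ∀ v → ∃ λ u → u ∈ S × _~_ G v u

Packing : Graph n → Pred (Subset n) 0ℓ
Packing G S = ∀ u v → u ∈ S → v ∈ S → u ≢ v → Empty (N[ G ] u ∩ N[ G ] v)

EfficientOpenDomination : Graph n → Set
EfficientOpenDomination {n} G =
  Σ[ D ∈ Subset n ]
    (∀ v → ∃ λ u → u ∈ D × v ∈ N G u) ×
    (∀ u v → u ∈ D → v ∈ D → u ≢ v → Empty (N G u ∩ N G v))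

EfficientClosedDomination : Graph n → Set
EfficientClosedDomination {n} G =
  Σ[ S ∈ Subset n ] Dominating G S × Packing G S

dominating? : (G : Graph n) → Decidable (Dominating G)
dominating? G S = all? λ v → ¬? (v ∈? S) →-dec
  any? λ u → (u ∈? S) ×-dec _~?_ G v u

perfectDominating? : (G : Graph n) → Decidable (PerfectDominating G)
perfectDominating? G S = all? λ v → ¬? (v ∈? S) →-dec ∃!? (λ u → (u ∈? S) ×-dec _~?_ G v u)
  where
  ∃!? : ∀ {n} {P : Pred (Fin n) 0ℓ} → Decidable P → Dec (∃! _≡_ P)
  ∃!? P? = map′
    (λ (x , px , uniq) → x , px , λ {y} → uniq y)
    (λ (x , px , uniq) → x , px , λ y → uniq {y})
    (any? λ x → P? x ×-dec all? λ y → P? y →-dec (x ≟ y))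

totalDominating? : (G : Graph n) → Decidable (TotalDominating G)
totalDominating? G S = all? λ v → any? λ u → (u ∈? S) ×-dec _~?_ G v u

subsets : ∀ n → List (Subset n)
subsets zero    = [ [] ]
subsets (suc n) = map (inside ∷_) (subsets n) ++ map (outside ∷_) (subsets n)

∈-subsets : (S : Subset n) → S ∈ˡ subsets n
∈-subsets []            = here refl
∈-subsets (inside  ∷ S) = ∈-++⁺ˡ (∈-map⁺ (inside ∷_) (∈-subsets S))
∈-subsets (outside ∷ S) =
  ∈-++⁺ʳ (map (inside ∷_) (subsets _)) (∈-map⁺ (outside ∷_) (∈-subsets S))

-- The default n never undercuts the size of a subset of Fin n, so this is the
-- true minimum whenever P is satisfiable (see the next two lemmas); it is n
-- when P is not.
minimumSize : {P : Pred (Subset n) 0ℓ} → Decidable P → ℕ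
minimumSize {n} P? = min n (map ∣_∣ (filter P? (subsets n)))

minimumSize-≤ : {P : Pred (Subset n) 0ℓ} (P? : Decidable P) →
                ∀ {S} → P S → minimumSize P? ≤ ∣ S ∣
minimumSize-≤ {n} P? {S} pS =
  All.lookup (min≤xs n (map ∣_∣ (filter P? (subsets n))))
    (∈-map⁺ ∣_∣ (∈-filter⁺ P? (∈-subsets S) pS))

minimumSize-attained : {P : Pred (Subset n) 0ℓ} (P? : Decidable P) →
                       ∃ P → ∃ λ S → P S × ∣ S ∣ ≡ minimumSize P?
minimumSize-attained {n} P? (T , pT)
  with argmin-sel id n (map ∣_∣ (filter P? (subsets n)))
... | inj₁ min≡n = T , pT ,
  ≤-antisym (≤-trans (∣p∣≤n T) (≤-reflexive (sym min≡n))) (minimumSize-≤ P? pT)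
... | inj₂ min∈ with ∈-map⁻ ∣_∣ min∈
...   | S , S∈ , min≡∣S∣ with ∈-filter⁻ P? {xs = subsets n} S∈
...     | _ , pS = S , pS , sym min≡∣S∣

γ : Graph n → ℕ
γ G = minimumSize (dominating? G)

γᵖ : Graph n → ℕ
γᵖ G = minimumSize (perfectDominating? G)

-- Meaningful only for graphs without isolated vertices, since no other graph
-- has a total dominating set.
γₜ : Graph n → ℕ
γₜ G = minimumSize (totalDominating? G)

-- The vertex set Fin m × Fin n is encoded as Fin (m * n) through the bijection
-- `remQuot n`, whose inverse is `combine`.  `×-Lex _≡_ R T` relates (u , v) to
-- (x , y) iff R u x, or u ≡ x and T v y.
infixr 9 _∘_
_∘_ : Graph m → Graph n → Graph (m * n)
_∘_ {m} {n} G H = record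
  { _~_    = _≈_ on remQuot {m} n
  ; _~?_   = λ p q → ×-decidable _≟_ (_~?_ G) (_~?_ H) (remQuot n p) (remQuot n q)
  ; symm   = λ { (inj₁ a)       → inj₁ (symm G a)
               ; (inj₂ (e , b)) → inj₂ (sym e , symm H b) }
  ; irrefl = λ { refl (inj₁ a)       → irrefl G refl a
               ; refl (inj₂ (_ , b)) → irrefl H refl b }
  }
  where
  _≈_ : Rel (Fin m × Fin n) 0ℓ
  _≈_ = ×-Lex _≡_ (_~_ G) (_~_ H)

{-# OPTIONS --safe #-}

-- Let S be a perfect dominating set of G ∘ H and D its projection to G.  A
-- missing vertex (u , h) sees all of S lying over the neighbours of u.  So if
-- some vertex of the fibre over u is missing, no fibre over a neighbour of u
-- is full, and by connectedness either S is everything or no fibre is full.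
-- In the latter case, if D has two adjacent vertices u and x, a neighbour
-- (u , h') of some (u , h) ∈ S would produce a missing vertex with two
-- neighbours in S; hence h is isolated in H, and every vertex of G has exactly
-- one neighbour in D.  If D is independent, take u ∈ D: every vertex over a
-- neighbour of u is missing, so S has a single vertex (u , k) over u, and it
-- must dominate its whole fibre; hence k is universal in H and D is both
-- dominating and a packing.

module Submission where

open import Data.Nat using (ℕ; zero; suc; _*_; _≤_; _<_; z≤n; s≤s)
open import Data.Nat.Properties
  using (≤-antisym; ≤-reflexive; ≤-trans; n≤0⇒n≡0)
open import Data.Fin using (Fin; zero; suc; combine; remQuot)
open import Data.Fin.Properties
  using (_≟_; all?; any?; ¬∀⟶∃¬; suc-injective; remQuot-combine; combine-surjective;
         combine-injectiveˡ; combine-injectiveʳ)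
open import Data.Fin.Subset
  using (Subset; inside; outside; _∈_; ⁅_⁆; ∣_∣; ⊤; _-_; Empty)
open import Data.Fin.Subset.Properties
  using (_∈?_; ∣p∣≤n; ∈⊤; ∣⊤∣≡n; ∣⊥∣≡0; Empty-unique; nonempty?; x∈⁅x⁆;
         x∈⁅y⁆⇒x≡y; ∣⁅x⁆∣≡1; x∈p∩q⁺; x∈p∩q⁻; x∈p∪q⁺; x∈p∪q⁻;
         x∈p∧x≢y⇒x∈p-y; x∈p⇒∣p-x∣<∣p∣; p⊆q⇒∣p∣≤∣q∣)
open import Data.List using (map; allFin)
open import Data.List.Extrema.Nat using (min≤xs; argmin-sel)
open import Data.List.Membership.Propositional.Properties using (∈-map⁺; ∈-map⁻; ∈-allFin)
import Data.List.Relation.Unary.All as All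
open import Data.Product using (_×_; _,_; proj₁; proj₂; ∃; ∃₂)
open import Data.Product.Relation.Binary.Lex.Strict using (×-Lex)
open import Data.Sum using (_⊎_; inj₁; inj₂)
open import Data.Vec using (tabulate; []; _∷_; here; there)
open import Data.Vec.Properties using (lookup∘tabulate; []=⇒lookup; lookup⇒[]=)
open import Function using (id)
open import Level using (0ℓ)
open import Relation.Binary.Core using (Rel; REL)
open import Relation.Binary.Construct.Closure.ReflexiveTransitive using (Star; ε; _◅_)
open import Relation.Binary.PropositionalEquality
  using (_≡_; _≢_; refl; sym; trans; cong; subst; subst₂)
open import Relation.Nullary using (yes; no; does; ¬_; ¬?; contradiction; _×-dec_)
open import Relation.Nullary.Decidable using (dec-true; decidable-stable)
open import Relation.Unary using (Pred; Decidable)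
open import Defs

open Graph

private
  variable
    m n : ℕ

-- Finite subsets

module _ {P : Pred (Fin n) 0ℓ} (P? : Decidable P) where

  ⟦_⟧ : Subset n
  ⟦_⟧ = tabulate λ x → does (P? x)

  ∈-⟦⟧⁺ : ∀ {x} → P x → x ∈ ⟦_⟧
  ∈-⟦⟧⁺ {x} px = lookup⇒[]= x ⟦_⟧ (trans (lookup∘tabulate _ x) (dec-true (P? x) px))

  ∈-⟦⟧⁻ : ∀ {x} → x ∈ ⟦_⟧ → P x
  ∈-⟦⟧⁻ {x} x∈ with P? x | trans (sym (lookup∘tabulate (λ y → does (P? y)) x)) ([]=⇒lookup x∈)
  ... | yes px | _  = px
  ... | no _   | ()

-- Induction on `S`: the partner `y` of the head is deleted from `T`, and injectivity keeps the
-- partners of later elements away from `y`. A relation instead of a function lets adjacency itself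
-- serve as the matching in the counting arguments.
∣∣-mono-injection : ∀ (S : Subset m) (T : Subset n) (R : REL (Fin m) (Fin n) 0ℓ) →
                    (∀ {x} → x ∈ S → ∃ λ y → y ∈ T × R x y) →
                    (∀ {x x′ y} → x ∈ S → x′ ∈ S → R x y → R x′ y → x ≡ x′) →
                    ∣ S ∣ ≤ ∣ T ∣
∣∣-mono-injection []            T R total inj = z≤n
∣∣-mono-injection (outside ∷ S) T R total inj =
  ∣∣-mono-injection S T (λ x → R (suc x)) (λ x∈ → total (there x∈))
    λ x∈ x′∈ r r′ → suc-injective (inj (there x∈) (there x′∈) r r′)
∣∣-mono-injection (inside ∷ S) T R total inj with total here
... | y , y∈T , r₀ = ≤-trans (s≤s ∣S∣≤∣T-y∣) (x∈p⇒∣p-x∣<∣p∣ y∈T)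
  where
  ∣S∣≤∣T-y∣ : ∣ S ∣ ≤ ∣ T - y ∣
  ∣S∣≤∣T-y∣ = ∣∣-mono-injection S (T - y) (λ x → R (suc x))
    (λ x∈ → let z , z∈T , r = total (there x∈) in
      z , x∈p∧x≢y⇒x∈p-y z∈T (λ { refl → contradiction (inj here (there x∈) r₀ r) λ () }) , r)
    λ x∈ x′∈ r r′ → suc-injective (inj (there x∈) (there x′∈) r r′)

x∈p⇒0<∣p∣ : ∀ {p : Subset n} {x} → x ∈ p → 0 < ∣ p ∣
x∈p⇒0<∣p∣ x∈p = ≤-trans (s≤s z≤n) (x∈p⇒∣p-x∣<∣p∣ x∈p)

Empty⇒∣p∣≡0 : ∀ {p : Subset n} → Empty p → ∣ p ∣ ≡ 0
Empty⇒∣p∣≡0 {n} ¬∃ = trans (cong ∣_∣ (Empty-unique ¬∃)) (∣⊥∣≡0 n)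

∣p∣≡1⇒singleton : ∀ (p : Subset n) → ∣ p ∣ ≡ 1 → ∃ λ x → x ∈ p × (∀ {y} → y ∈ p → y ≡ x)
∣p∣≡1⇒singleton p ∣p∣≡1 with nonempty? p
... | no ¬∃ = contradiction (trans (sym ∣p∣≡1) (Empty⇒∣p∣≡0 ¬∃)) λ ()
... | yes (x , x∈p) = x , x∈p , unique
  where
  unique : ∀ {y} → y ∈ p → y ≡ x
  unique {y} y∈p with y ≟ x
  ... | yes y≡x = y≡x
  ... | no  y≢x = contradiction
    (subst (2 ≤_) ∣p∣≡1 (≤-trans (s≤s (x∈p⇒0<∣p∣ (x∈p∧x≢y⇒x∈p-y y∈p y≢x))) (x∈p⇒∣p-x∣<∣p∣ x∈p)))
    λ { (s≤s ()) }

∃-≢ : 2 ≤ n → ∀ (x : Fin n) → ∃ λ y → y ≢ x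
∃-≢ (s≤s (s≤s _)) zero    = suc zero , λ ()
∃-≢ (s≤s (s≤s _)) (suc x) = zero , λ ()

∃-Fin : 2 ≤ n → Fin n
∃-Fin (s≤s _) = zero

-- Graphs

Isolated : Graph n → Fin n → Set
Isolated G v = ∀ u → ¬ (_~_ G v u)

Universal : Graph n → Fin n → Set
Universal G v = ∀ u → u ≢ v → _~_ G u v

module _ (G : Graph n) where

  ∈N⁺ : ∀ {v u} → _~_ G v u → u ∈ N G v
  ∈N⁺ {v} = ∈-⟦⟧⁺ (_~?_ G v)

  ∈N⁻ : ∀ {v u} → u ∈ N G v → _~_ G v u
  ∈N⁻ {v} = ∈-⟦⟧⁻ (_~?_ G v)

  ∈N[]-self : ∀ v → v ∈ N[ G ] v
  ∈N[]-self v = x∈p∪q⁺ (inj₂ (x∈⁅x⁆ v))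

  ∈N[]-nbr : ∀ {v u} → _~_ G v u → u ∈ N[ G ] v
  ∈N[]-nbr e = x∈p∪q⁺ (inj₁ (∈N⁺ e))

  ∈N[]⁻ : ∀ {v u} → u ∈ N[ G ] v → _~_ G v u ⊎ u ≡ v
  ∈N[]⁻ {v} u∈ with x∈p∪q⁻ (N G v) ⁅ v ⁆ u∈
  ... | inj₁ u∈N = inj₁ (∈N⁻ u∈N)
  ... | inj₂ u∈v = inj₂ (x∈⁅y⁆⇒x≡y v u∈v)

  nbr-exists : Connected G → Nontrivial G → ∀ u → ∃ (_~_ G u)
  nbr-exists conn nt u with ∃-≢ nt u
  ... | v , v≢u with conn u v
  ... | ε     = contradiction refl v≢u
  ... | e ◅ _ = _ , e

  δ≡0⇒isolated : Nontrivial G → δ G ≡ 0 → ∃ (Isolated G)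
  δ≡0⇒isolated nt δ≡0 with argmin-sel id n (map (deg G) (allFin n))
  -- The minimum may be the default value `n`, but that is at least 2 and not 0.
  ... | inj₁ δ≡n = contradiction (subst (2 ≤_) (trans (sym δ≡n) δ≡0) nt) λ ()
  ... | inj₂ δ∈ with ∈-map⁻ (deg G) δ∈
  ...   | v , _ , δ≡deg = v , λ u e →
    contradiction (subst (0 <_) (trans (sym δ≡deg) δ≡0) (x∈p⇒0<∣p∣ (∈N⁺ e))) λ ()

  isolated⇒δ≡0 : ∀ {v} → Isolated G v → δ G ≡ 0
  isolated⇒δ≡0 {v} iso = n≤0⇒n≡0 (≤-trans
    (All.lookup (min≤xs n (map (deg G) (allFin n))) (∈-map⁺ (deg G) (∈-allFin v)))
    (≤-reflexive (Empty⇒∣p∣≡0 λ (u , u∈) → iso u (∈N⁻ u∈))))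

  γ-attained : ∃ λ S → Dominating G S × ∣ S ∣ ≡ γ G
  γ-attained = minimumSize-attained (dominating? G) (⊤ , λ v v∉ → contradiction ∈⊤ v∉)

  γᵖ-attained : ∃ λ S → PerfectDominating G S × ∣ S ∣ ≡ γᵖ G
  γᵖ-attained = minimumSize-attained (perfectDominating? G) (⊤ , λ v v∉ → contradiction ∈⊤ v∉)

  γ≡1⇒universal : γ G ≡ 1 → ∃ (Universal G)
  γ≡1⇒universal γ≡1 with γ-attained
  ... | S , dom , ∣S∣≡γ with ∣p∣≡1⇒singleton S (trans ∣S∣≡γ γ≡1)
  ...   | v , v∈S , uniq = v , λ u u≢v →
    let w , w∈S , e = dom u (λ u∈S → u≢v (uniq u∈S)) in subst (_~_ G u) (uniq w∈S) e

  universal⇒γ≡1 : ∀ {v} → Universal G v → γ G ≡ 1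
  universal⇒γ≡1 {v} univ = ≤-antisym
    (≤-trans (minimumSize-≤ (dominating? G) dom) (≤-reflexive (∣⁅x⁆∣≡1 v)))
    (let S , domS , ∣S∣≡γ = γ-attained in subst (0 <_) ∣S∣≡γ (0<∣S∣ S domS))
    where
    dom : Dominating G ⁅ v ⁆
    dom u u∉ = v , x∈⁅x⁆ v , univ u (λ { refl → u∉ (x∈⁅x⁆ v) })

    -- The vertex `v` is in `S` or has a neighbour there.
    0<∣S∣ : ∀ S → Dominating G S → 0 < ∣ S ∣
    0<∣S∣ S domS with v ∈? S
    ... | yes v∈S = x∈p⇒0<∣p∣ v∈S
    ... | no  v∉S = x∈p⇒0<∣p∣ (proj₁ (proj₂ (domS v v∉S)))

  -- Applied to `H`, this makes the two exceptional cases of the theorem exclude each other.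
  universal⇒¬isolated : Nontrivial G → ∀ {v u} → Universal G v → ¬ Isolated G u
  universal⇒¬isolated nt {v} {u} univ iso with u ≟ v
  ... | no u≢v = iso v (univ u u≢v)
  ... | yes refl with ∃-≢ nt u
  ...   | w , w≢u = iso w (symm G (univ w w≢u))

-- D meets N(v) (resp. N[v]) in exactly one vertex, for every v.

record OpenEfficient (G : Graph n) (D : Subset n) : Set where
  field
    nbr  : ∀ v → ∃ λ u → u ∈ D × _~_ G v u
    uniq : ∀ {v u w} → u ∈ D → w ∈ D → _~_ G v u → _~_ G v w → u ≡ w

  -- Each u ∈ D has a neighbour in T, and u is the only vertex of D adjacent to it.
  ∣D∣≤∣T∣ : ∀ {T} → TotalDominating G T → ∣ D ∣ ≤ ∣ T ∣
  ∣D∣≤∣T∣ {T} tot = ∣∣-mono-injection D T (_~_ G) (λ {x} _ → tot x)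
    λ x∈ y∈ e e′ → uniq x∈ y∈ (symm G e) (symm G e′)

  ∣D∣≤γₜ : ∣ D ∣ ≤ γₜ G
  ∣D∣≤γₜ with minimumSize-attained (totalDominating? G) (D , nbr)
  ... | T , tot , ∣T∣≡γₜ = ≤-trans (∣D∣≤∣T∣ tot) (≤-reflexive ∣T∣≡γₜ)

  γₜ≤∣D∣ : γₜ G ≤ ∣ D ∣
  γₜ≤∣D∣ = minimumSize-≤ (totalDominating? G) nbr

record ClosedEfficient (G : Graph n) (D : Subset n) : Set where
  field
    dominating : Dominating G D
    indep      : ∀ {u w} → u ∈ D → w ∈ D → ¬ (_~_ G u w)
    uniq       : ∀ {v u w} → u ∈ D → w ∈ D → _~_ G v u → _~_ G v w → u ≡ w

  -- Disjointness of closed neighbourhoods in pointwise form. In the mixed cases `u` and `w` would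
  -- be adjacent, against `indep`.
  closed-uniq : ∀ {u w t} → u ∈ D → w ∈ D →
                _~_ G u t ⊎ t ≡ u → _~_ G w t ⊎ t ≡ w → u ≡ w
  closed-uniq u∈ w∈ (inj₂ refl) (inj₂ refl) = refl
  closed-uniq u∈ w∈ (inj₂ refl) (inj₁ e)    = contradiction e (indep w∈ u∈)
  closed-uniq u∈ w∈ (inj₁ e)    (inj₂ refl) = contradiction e (indep u∈ w∈)
  closed-uniq u∈ w∈ (inj₁ e)    (inj₁ e′)   = uniq u∈ w∈ (symm G e) (symm G e′)

  -- Every closed neighbourhood meets `T`, and by `closed-uniq` those of distinct vertices of `D`
  -- meet it in different places.
  ∣D∣≤∣T∣ : ∀ {T} → Dominating G T → ∣ D ∣ ≤ ∣ T ∣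
  ∣D∣≤∣T∣ {T} dom = ∣∣-mono-injection D T (λ u t → _~_ G u t ⊎ t ≡ u) total closed-uniq
    where
    total : ∀ {u} → u ∈ D → ∃ λ t → t ∈ T × (_~_ G u t ⊎ t ≡ u)
    total {u} _ with u ∈? T
    ... | yes u∈T = u , u∈T , inj₂ refl
    ... | no  u∉T = let t , t∈T , e = dom u u∉T in t , t∈T , inj₁ e

  ∣D∣≤γ : ∣ D ∣ ≤ γ G
  ∣D∣≤γ with γ-attained G
  ... | T , dom , ∣T∣≡γ = ≤-trans (∣D∣≤∣T∣ dom) (≤-reflexive ∣T∣≡γ)

  γ≤∣D∣ : γ G ≤ ∣ D ∣
  γ≤∣D∣ = minimumSize-≤ (dominating? G) dominating

-- Translation to and from efficient domination graphs

module _ {G : Graph n} where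

  EOD⇒OpenEfficient : EfficientOpenDomination G → ∃ (OpenEfficient G)
  EOD⇒OpenEfficient (D , cover , disjoint) = D , record
    { nbr  = λ v → let u , u∈D , v∈N = cover v in u , u∈D , symm G (∈N⁻ G v∈N)
    ; uniq = λ {v} {u} {w} u∈D w∈D e e′ → decidable-stable (u ≟ w) λ u≢w →
        disjoint u w u∈D w∈D u≢w
          (v , x∈p∩q⁺ (∈N⁺ G (symm G e) , ∈N⁺ G (symm G e′)))
    }

  OpenEfficient⇒EOD : ∀ {D} → OpenEfficient G D → EfficientOpenDomination G
  OpenEfficient⇒EOD {D} eff = D
    , (λ v → let u , u∈D , e = nbr v in u , u∈D , ∈N⁺ G (symm G e))
    , λ u w u∈D w∈D u≢w (v , v∈) →
        let v∈Nu , v∈Nw = x∈p∩q⁻ (N G u) (N G w) v∈ in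
        u≢w (uniq u∈D w∈D (symm G (∈N⁻ G v∈Nu)) (symm G (∈N⁻ G v∈Nw)))
    where open OpenEfficient eff

  ECD⇒ClosedEfficient : EfficientClosedDomination G → ∃ (ClosedEfficient G)
  ECD⇒ClosedEfficient (D , dom , pack) = D , record
    { dominating = dom
    ; indep      = λ {u} {w} u∈D w∈D e →
        pack u w u∈D w∈D (λ u≡w → irrefl G u≡w e)
          (w , x∈p∩q⁺ (∈N[]-nbr G e , ∈N[]-self G w))
    ; uniq       = λ {v} {u} {w} u∈D w∈D e e′ → decidable-stable (u ≟ w) λ u≢w →
        pack u w u∈D w∈D u≢w
          (v , x∈p∩q⁺ (∈N[]-nbr G (symm G e) , ∈N[]-nbr G (symm G e′)))
    }

  ClosedEfficient⇒ECD : ∀ {D} → ClosedEfficient G D → EfficientClosedDomination G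
  ClosedEfficient⇒ECD {D} eff = D , dominating , λ u w u∈D w∈D u≢w (v , v∈) →
    let v∈Nu , v∈Nw = x∈p∩q⁻ (N[ G ] u) (N[ G ] w) v∈ in
    u≢w (closed-uniq u∈D w∈D (∈N[]⁻ G v∈Nu) (∈N[]⁻ G v∈Nw))
    where open ClosedEfficient eff

-- Lexicographic products

module _ (G : Graph m) (H : Graph n) where

  infix 4 _≈_
  _≈_ : Rel (Fin m × Fin n) 0ℓ
  _≈_ = ×-Lex _≡_ (_~_ G) (_~_ H)

  ∘-adj⁺ : ∀ {u h x k} → (u , h) ≈ (x , k) → _~_ (G ∘ H) (combine u h) (combine x k)
  ∘-adj⁺ {u} {h} {x} {k} =
    subst₂ _≈_ (sym (remQuot-combine u h)) (sym (remQuot-combine x k))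

  ∘-adj⁻ : ∀ {u h x k} → _~_ (G ∘ H) (combine u h) (combine x k) → (u , h) ≈ (x , k)
  ∘-adj⁻ {u} {h} {x} {k} = subst₂ _≈_ (remQuot-combine u h) (remQuot-combine x k)

-- Copies of a set of vertices of `G` in one layer of the product

module _ (D : Subset m) (k : Fin n) where

  private
    P : Pred (Fin (m * n)) 0ℓ
    P p = proj₁ (remQuot {m} n p) ∈ D × proj₂ (remQuot {m} n p) ≡ k

    P? : Decidable P
    P? p = (proj₁ (remQuot {m} n p) ∈? D) ×-dec (proj₂ (remQuot {m} n p) ≟ k)

  slice : Subset (m * n)
  slice = ⟦ P? ⟧

  ∈-slice⁺ : ∀ {u} → u ∈ D → combine u k ∈ slice
  ∈-slice⁺ {u} u∈D = ∈-⟦⟧⁺ P?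
    (subst (λ q → proj₁ q ∈ D × proj₂ q ≡ k) (sym (remQuot-combine u k)) (u∈D , refl))

  ∈-slice⁻ : ∀ {u h} → combine u h ∈ slice → u ∈ D × h ≡ k
  ∈-slice⁻ {u} {h} p∈ =
    subst (λ q → proj₁ q ∈ D × proj₂ q ≡ k) (remQuot-combine u h) (∈-⟦⟧⁻ P? p∈)

  ∣slice∣≤∣D∣ : ∣ slice ∣ ≤ ∣ D ∣
  ∣slice∣≤∣D∣ = ∣∣-mono-injection slice D (λ p u → p ≡ combine u k) total
    λ { _ _ refl refl → refl }
    where
    total : ∀ {p} → p ∈ slice → ∃ λ u → u ∈ D × p ≡ combine u k
    total {p} p∈ with combine-surjective {m} {n} p
    ... | u , h , refl with ∈-slice⁻ p∈
    ...   | u∈D , refl = u , u∈D , refl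

  -- Distinct vertices have disjoint fibres, so their lifts to `T` are distinct.
  ∣D∣≤∣T∣-over : ∀ {T : Subset (m * n)} → (∀ {u} → u ∈ D → ∃ λ h → combine u h ∈ T) →
                 ∣ D ∣ ≤ ∣ T ∣
  ∣D∣≤∣T∣-over {T} lift = ∣∣-mono-injection D T (λ u p → ∃ λ h → p ≡ combine u h)
    (λ u∈D → let h , p∈T = lift u∈D in _ , p∈T , h , refl)
    λ { {u} {w} _ _ (h , refl) (k , eq) → combine-injectiveˡ u h w k eq }

module _ (G : Graph m) (H : Graph n) {D : Subset m} {k : Fin n} where

  -- As `k` is isolated, no vertex has a slice neighbour in its own fibre. So the slice neighbours
  -- of `(u , h)` correspond to the neighbours of `u` in `D`, of which there is exactly one.
  slice-perfect-open : OpenEfficient G D → Isolated H k →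
                       PerfectDominating (G ∘ H) (slice D k)
  slice-perfect-open eff iso p _ with combine-surjective {m} {n} p
  ... | u , h , refl with OpenEfficient.nbr eff u
  ...   | x , x∈D , e = combine x k , (∈-slice⁺ D k x∈D , ∘-adj⁺ G H (inj₁ e)) , only
    where
    only : ∀ {q} → q ∈ slice D k × _~_ (G ∘ H) (combine u h) q → combine x k ≡ q
    only {q} (q∈ , a) with combine-surjective {m} {n} q
    ... | y , l , refl with ∈-slice⁻ D k q∈ | ∘-adj⁻ G H a
    ...   | y∈D , refl | inj₁ e′      =
      cong (λ z → combine z k) (OpenEfficient.uniq eff x∈D y∈D e e′)
    ...   | y∈D , refl | inj₂ (_ , f) = contradiction (symm H f) (iso h)

  -- Over `u ∈ D`, universality of `k` makes `(u , k)` a neighbour, and independence of `D` excludes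
  -- any other. Over `u ∉ D`, the fibre misses the slice and the single neighbour of `u` in `D`
  -- decides.
  slice-perfect-closed : ClosedEfficient G D → Universal H k →
                         PerfectDominating (G ∘ H) (slice D k)
  slice-perfect-closed eff univ p p∉ with combine-surjective {m} {n} p
  ... | u , h , refl with u ∈? D
  ...   | yes u∈D = combine u k , (∈-slice⁺ D k u∈D , ∘-adj⁺ G H (inj₂ (refl , univ h h≢k))) , only
    where
    h≢k : h ≢ k
    h≢k refl = p∉ (∈-slice⁺ D k u∈D)

    only : ∀ {q} → q ∈ slice D k × _~_ (G ∘ H) (combine u h) q → combine u k ≡ q
    only {q} (q∈ , a) with combine-surjective {m} {n} q
    ... | y , l , refl with ∈-slice⁻ D k q∈ | ∘-adj⁻ G H a
    ...   | y∈D , refl | inj₁ e          = contradiction e (ClosedEfficient.indep eff u∈D y∈D)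
    ...   | y∈D , refl | inj₂ (refl , _) = refl
  ...   | no u∉D with ClosedEfficient.dominating eff u u∉D
  ...     | x , x∈D , e = combine x k , (∈-slice⁺ D k x∈D , ∘-adj⁺ G H (inj₁ e)) , only
    where
    only : ∀ {q} → q ∈ slice D k × _~_ (G ∘ H) (combine u h) q → combine x k ≡ q
    only {q} (q∈ , a) with combine-surjective {m} {n} q
    ... | y , l , refl with ∈-slice⁻ D k q∈ | ∘-adj⁻ G H a
    ...   | y∈D , refl | inj₁ e′         =
      cong (λ z → combine z k) (ClosedEfficient.uniq eff x∈D y∈D e e′)
    ...   | y∈D , refl | inj₂ (refl , _) = contradiction y∈D u∉D

-- Structure of a perfect dominating set of the product

module PerfectDominationInProduct
  (G : Graph m) (H : Graph n)
  (conn : Connected G) (ntG : Nontrivial G) (ntH : Nontrivial H)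
  {S : Subset (m * n)} (perfect : PerfectDominating (G ∘ H) S)
  where

  private
    infix 4 _≋_
    _≋_ : Rel (Fin m × Fin n) 0ℓ
    _≋_ = _≈_ G H

    P : Fin m → Fin n → Set
    P u h = combine u h ∈ S

  S-nbr : ∀ {u h} → ¬ P u h → ∃₂ λ x k → P x k × (u , h) ≋ (x , k)
  S-nbr ¬P with perfect _ ¬P
  ... | q , (q∈S , a) , _ with combine-surjective {m} {n} q
  ...   | x , k , refl = x , k , q∈S , ∘-adj⁻ G H a

  -- The main tool below: two candidate neighbours of a missing vertex are compared, and each
  -- application reads off just one of the two coordinates.
  S-nbr-unique : ∀ {u h x k y l} → ¬ P u h → P x k → (u , h) ≋ (x , k) →
                 P y l → (u , h) ≋ (y , l) → x ≡ y × k ≡ l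
  S-nbr-unique {x = x} {k} {y} {l} ¬P p a p′ a′ with perfect _ ¬P
  ... | _ , _ , uniq = combine-injectiveˡ x k y l eq , combine-injectiveʳ x k y l eq
    where
    eq : combine x k ≡ combine y l
    eq = trans (sym (uniq (p , ∘-adj⁺ G H a))) (uniq (p′ , ∘-adj⁺ G H a′))

  Missing : Fin m → Set
  Missing u = ∃ λ h → ¬ P u h

  missing-step : ∀ {u x} → _~_ G u x → Missing u → Missing x
  missing-step {u} {x} e (h , ¬P) with any? (λ k → ¬? (combine x k ∈? S))
  ... | yes found = found
  -- Were the fibre over `x` full, `(u , h)` would see two vertices of `S` there, because `H` is
  -- nontrivial.
  ... | no  none  = contradiction
    (proj₂ (S-nbr-unique ¬P (full k₁) (inj₁ e) (full k₀) (inj₁ e))) k₁≢k₀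
    where
    full : ∀ k → P x k
    full k = decidable-stable (combine x k ∈? S) λ k∉ → none (k , k∉)

    k₀ : Fin n
    k₀ = ∃-Fin ntH

    k₁ : Fin n
    k₁ = proj₁ (∃-≢ ntH k₀)

    k₁≢k₀ : k₁ ≢ k₀
    k₁≢k₀ = proj₂ (∃-≢ ntH k₀)

  missing-star : ∀ {u x} → Star (_~_ G) u x → Missing u → Missing x
  missing-star ε        mis = mis
  missing-star (e ◅ es) mis = missing-star es (missing-step e mis)

  inD? : Decidable λ u → ∃ (P u)
  inD? u = any? λ h → combine u h ∈? S

  D : Subset m
  D = ⟦ inD? ⟧

  ∈D⁺ : ∀ {u h} → P u h → u ∈ D
  ∈D⁺ {h = h} p = ∈-⟦⟧⁺ inD? (h , p)

  ∈D⁻ : ∀ {u} → u ∈ D → ∃ (P u)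
  ∈D⁻ = ∈-⟦⟧⁻ inD?

  ∣D∣≤∣S∣ : ∣ D ∣ ≤ ∣ S ∣
  ∣D∣≤∣S∣ = ∣D∣≤∣T∣-over D (∃-Fin ntH) ∈D⁻

  module _ (missing : ∀ u → Missing u) where

    D-nbr-unique : ∀ {v u w} → u ∈ D → w ∈ D → _~_ G v u → _~_ G v w → u ≡ w
    D-nbr-unique {v} u∈D w∈D e e′ =
      proj₁ (S-nbr-unique (proj₂ (missing v)) (proj₂ (∈D⁻ u∈D)) (inj₁ e) (proj₂ (∈D⁻ w∈D)) (inj₁ e′))

    -- Let `h′` be a neighbour of `h`. If `(u , h′)` is in `S`, a missing vertex over `x` sees both
    -- it and `(u , h)`. If not, `(u , h′)` sees `(u , h)` in its own fibre and `(x , k)` in the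
    -- adjacent one.
    adjacent-in-D⇒isolated : ∀ {u x} → u ∈ D → x ∈ D → _~_ G u x → ∃ (Isolated H)
    adjacent-in-D⇒isolated {u} {x} u∈D x∈D e with ∈D⁻ u∈D | ∈D⁻ x∈D
    ... | h , p | k , q = h , isolated
      where
      isolated : Isolated H h
      isolated h′ f with combine u h′ ∈? S
      ... | yes p′ = irrefl H
        (proj₂ (S-nbr-unique (proj₂ (missing x)) p (inj₁ (symm G e)) p′ (inj₁ (symm G e)))) f
      ... | no ¬p′ = irrefl G
        (proj₁ (S-nbr-unique ¬p′ p (inj₂ (refl , symm H f)) q (inj₁ e))) e

    -- The missing `(u , h)` already has its one `S`-neighbour in its own fibre, so `S` avoids the
    -- fibres over all neighbours of `u`. Hence the fibre over `u` has to be dominated from within,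
    -- and `(u , k)` turns out to be its only vertex in `S`.
    fibre-edge⇒universal : ∀ {u h k} → ¬ P u h → P u k → _~_ H h k → Universal H k
    fibre-edge⇒universal {u} {h} {k} ¬p q f l l≢k with nbr-exists G conn ntG u
    ... | w , e with w ∈? D
    ...   | yes w∈D = contradiction e (irrefl G
      (proj₁ (S-nbr-unique ¬p q (inj₂ (refl , f)) (proj₂ (∈D⁻ w∈D)) (inj₁ e))))
    -- With `w ∉ D`, the vertex `(w , h)` is missing and sees all of `S` over `u`. This forces `k`
    -- to be the only second coordinate there, in this case and in the last one.
    ...   | no w∉D with combine u l ∈? S
    ...     | yes r = contradiction
      (proj₂ (S-nbr-unique (λ s → w∉D (∈D⁺ {h = h} s)) r (inj₁ (symm G e)) q (inj₁ (symm G e)))) l≢k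
    ...     | no ¬r with S-nbr ¬r
    -- An `S`-neighbour of `(u , l)` in another fibre would be a second one for `(u , h)`.
    ...       | y , j , s , inj₁ e′ = contradiction e′ (irrefl G
      (proj₁ (S-nbr-unique ¬p q (inj₂ (refl , f)) s (inj₁ e′))))
    ...       | _ , j , s , inj₂ (refl , f′) = subst (_~_ H l)
      (proj₂ (S-nbr-unique (λ t → w∉D (∈D⁺ {h = h} t)) s (inj₁ (symm G e)) q (inj₁ (symm G e)))) f′

    -- A missing vertex over `v` cannot be dominated within its fibre: that would give `H` a
    -- universal vertex beside an isolated one. So its `S`-neighbour lies over a neighbour of `v`.
    openEfficient : ∀ {h} → Isolated H h → OpenEfficient G D
    openEfficient iso = record { nbr = nbr ; uniq = D-nbr-unique }
      where
      nbr : ∀ v → ∃ λ u → u ∈ D × _~_ G v u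
      nbr v with missing v
      ... | h , ¬p with S-nbr ¬p
      ...   | x , k , q , inj₁ e          = x , ∈D⁺ q , e
      ...   | _ , k , q , inj₂ (refl , f) =
        contradiction iso (universal⇒¬isolated H ntH (fibre-edge⇒universal ¬p q f))

    -- Independence forces a missing vertex over `u ∈ D` to be dominated within its own fibre, and
    -- such an edge yields the universal vertex.
    closedEfficient : (∀ {u w} → u ∈ D → w ∈ D → ¬ (_~_ G u w)) →
                      ∃ (Universal H) × ClosedEfficient G D
    closedEfficient indep = universal , record
      { dominating = dominating ; indep = indep ; uniq = D-nbr-unique }
      where
      dominating : Dominating G D
      -- The whole fibre over `v` is missing, so any second coordinate serves.
      dominating v v∉D with S-nbr {v} {∃-Fin ntH} (λ p → v∉D (∈D⁺ p))
      ... | x , k , q , inj₁ e          = x , ∈D⁺ q , e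
      ... | _ , k , q , inj₂ (refl , _) = contradiction (∈D⁺ q) v∉D

      some-in-D : ∃ (_∈ D)
      some-in-D with missing (∃-Fin ntG)
      ... | h , ¬p with S-nbr ¬p
      ...   | x , k , q , _ = x , ∈D⁺ q

      universal : ∃ (Universal H)
      universal with some-in-D
      ... | u , u∈D with missing u
      ...   | h , ¬p with S-nbr ¬p
      ...     | x , k , q , inj₁ e          = contradiction e (indep u∈D (∈D⁺ q))
      ...     | _ , k , q , inj₂ (refl , f) = k , fibre-edge⇒universal ¬p q f

  trichotomy : (∀ p → p ∈ S)
             ⊎ (∃ (Isolated H) × OpenEfficient G D)
             ⊎ (∃ (Universal H) × ClosedEfficient G D)
  trichotomy with all? (_∈? S)
  ... | yes full = inj₁ full
  ... | no ¬full = inj₂ non-full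
    where
    missing : ∀ u → Missing u
    missing u with ¬∀⟶∃¬ (m * n) (_∈ S) (_∈? S) ¬full
    ... | p , p∉S with combine-surjective {m} {n} p
    ...   | u₀ , h₀ , refl = missing-star (conn u₀ u) (h₀ , p∉S)

    non-full : (∃ (Isolated H) × OpenEfficient G D) ⊎ (∃ (Universal H) × ClosedEfficient G D)
    non-full with any? (λ u → any? λ x → (u ∈? D) ×-dec (x ∈? D) ×-dec _~?_ G u x)
    ... | yes (u , x , u∈D , x∈D , e) =
      let iso = adjacent-in-D⇒isolated missing u∈D x∈D e in
      inj₁ (iso , openEfficient missing (proj₂ iso))
    ... | no none = inj₂ (closedEfficient missing λ u∈D w∈D e → none (_ , _ , u∈D , w∈D , e))

-- Values of the perfect domination number in the three cases

module _ (G : Graph m) (H : Graph n)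
         (conn : Connected G) (ntG : Nontrivial G) (ntH : Nontrivial H) where

  open PerfectDominationInProduct G H conn ntG ntH using (trichotomy; ∣D∣≤∣S∣)

  private
    full⇒∣D∣≤∣S∣ : ∀ (D : Subset m) {S} → (∀ p → p ∈ S) → ∣ D ∣ ≤ ∣ S ∣
    full⇒∣D∣≤∣S∣ D full = ∣D∣≤∣T∣-over D (∃-Fin ntH) λ _ → ∃-Fin ntH , full _

  -- The upper bound comes from the slice of an efficient set at an isolated vertex of `H`. For the
  -- lower bound, a minimum `S` is full or projects onto an open efficient set, which is total
  -- dominating.
  γᵖ-open : δ H ≡ 0 → EfficientOpenDomination G → γᵖ (G ∘ H) ≡ γₜ G
  γᵖ-open δ≡0 eod with δ≡0⇒isolated H ntH δ≡0 | EOD⇒OpenEfficient eod | γᵖ-attained (G ∘ H)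
  ... | h , iso | D₀ , eff | S , perfect , ∣S∣≡γᵖ = ≤-antisym
    (≤-trans (minimumSize-≤ (perfectDominating? (G ∘ H)) (slice-perfect-open G H eff iso))
      (≤-trans (∣slice∣≤∣D∣ D₀ h) (OpenEfficient.∣D∣≤γₜ eff)))
    (subst (γₜ G ≤_) ∣S∣≡γᵖ lower)
    where
    lower : γₜ G ≤ ∣ S ∣
    lower with trichotomy perfect
    ... | inj₁ full                      = ≤-trans (OpenEfficient.γₜ≤∣D∣ eff) (full⇒∣D∣≤∣S∣ D₀ full)
    ... | inj₂ (inj₁ (_ , eff′))         = ≤-trans (OpenEfficient.γₜ≤∣D∣ eff′) (∣D∣≤∣S∣ perfect)
    ... | inj₂ (inj₂ ((_ , univ) , _))   = contradiction iso (universal⇒¬isolated H ntH univ)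

  -- The same two bounds, with the slice at a universal vertex and a closed efficient projection.
  γᵖ-closed : γ H ≡ 1 → EfficientClosedDomination G → γᵖ (G ∘ H) ≡ γ G
  γᵖ-closed γ≡1 ecd with γ≡1⇒universal H γ≡1 | ECD⇒ClosedEfficient ecd | γᵖ-attained (G ∘ H)
  ... | k , univ | D₀ , eff | S , perfect , ∣S∣≡γᵖ = ≤-antisym
    (≤-trans (minimumSize-≤ (perfectDominating? (G ∘ H)) (slice-perfect-closed G H eff univ))
      (≤-trans (∣slice∣≤∣D∣ D₀ k) (ClosedEfficient.∣D∣≤γ eff)))
    (subst (γ G ≤_) ∣S∣≡γᵖ lower)
    where
    lower : γ G ≤ ∣ S ∣
    lower with trichotomy perfect
    ... | inj₁ full                    = ≤-trans (ClosedEfficient.γ≤∣D∣ eff) (full⇒∣D∣≤∣S∣ D₀ full)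
    ... | inj₂ (inj₁ ((_ , iso) , _))  = contradiction iso (universal⇒¬isolated H ntH univ)
    ... | inj₂ (inj₂ (_ , eff′))       = ≤-trans (ClosedEfficient.γ≤∣D∣ eff′) (∣D∣≤∣S∣ perfect)

  -- By `trichotomy`, a minimum set that is not full would put `G` and `H` into one of the excluded
  -- cases.
  γᵖ-otherwise : ¬ (δ H ≡ 0 × EfficientOpenDomination G) →
                 ¬ (γ H ≡ 1 × EfficientClosedDomination G) →
                 γᵖ (G ∘ H) ≡ m * n
  γᵖ-otherwise ¬open ¬closed with γᵖ-attained (G ∘ H)
  ... | S , perfect , ∣S∣≡γᵖ with trichotomy perfect
  ...   | inj₁ full = trans (sym ∣S∣≡γᵖ)
    (≤-antisym (∣p∣≤n S) (≤-trans (≤-reflexive (sym (∣⊤∣≡n (m * n)))) (p⊆q⇒∣p∣≤∣q∣ {p = ⊤} λ _ → full _)))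
  ...   | inj₂ (inj₁ ((_ , iso) , eff)) =
    contradiction (isolated⇒δ≡0 H iso , OpenEfficient⇒EOD eff) ¬open
  ...   | inj₂ (inj₂ ((_ , univ) , eff)) =
    contradiction (universal⇒γ≡1 H univ , ClosedEfficient⇒ECD eff) ¬closed

theorem3p2 : ∀ {m n : ℕ} (G : Graph m) (H : Graph n) →
    Connected G → Nontrivial G → Nontrivial H →
    (δ H ≡ 0 × EfficientOpenDomination G → γᵖ (G ∘ H) ≡ γₜ G) ×
    (γ H ≡ 1 × EfficientClosedDomination G → γᵖ (G ∘ H) ≡ γ G) ×
    (¬ (δ H ≡ 0 × EfficientOpenDomination G) →
    ¬ (γ H ≡ 1 × EfficientClosedDomination G) →
    γᵖ (G ∘ H) ≡ m * n)
theorem3p2 G H conn ntG ntH =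
    (λ (δ≡0 , eod) → γᵖ-open G H conn ntG ntH δ≡0 eod)
  , (λ (γ≡1 , ecd) → γᵖ-closed G H conn ntG ntH γ≡1 ecd)
  , γᵖ-otherwise G H conn ntG ntH
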